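{- Let $d_1>d_2>1$ and $f\ge0$ be integers, let $n=d_1+d_2+f$, and let $\beta\in\mathcal S_n$ have cycle structure $d_1\cdot d_2\cdot1^f$ (one $d_1$-cycle, one $d_2$-cycle, $f$ fixed points). Then $(\varepsilon,\beta,\beta;(12))\in\mathrm{Par}(n)$ if and only if $d_1/d_2$ is an odd integer and $f=0$.
   Context: A Latin square of order $n$ is an $n\times n$ array with rows, columns and symbols indexed by $[n]$, each symbol occurring once in each row and each column, with triple set $O(L)$. Permutations act on the right; $\varepsilon$ is the identity. A paratopism $(\alpha,\beta,\gamma;(12))$ maps $L$ to $L^\sigma$ with triple set $\{(y\beta,x\alpha,z\gamma):(x,y,z)\in O(L)\}$; it is an autoparatopism of $L$ if $L^\sigma=L$. $\mathrm{Par}(n)$ is the set of paratopisms that are autoparatopisms of at least one Latin square of order $n$. -}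

module Defs where

open import Data.Fin.Base using (Fin; zero; suc; toℕ)
open import Data.Fin.Permutation using (Permutation′; _⟨$⟩ʳ_; _⟨$⟩ˡ_; transpose)
open import Data.List.Base using (List; length; lookup)
open import Data.List.Relation.Unary.All using (All)
open import Data.Nat.Base using (ℕ; suc; _≤_)
open import Data.Nat.DivMod using (_mod_)
open import Data.Product using (Σ; Σ-syntax; ∃-syntax; ∃!; _×_; _,_)
open import Data.Vec.Base as Vec using (Vec; []; _∷_; tabulate)
open import Function.Bundles using (_↔_; Inverse)
open import Level using (0ℓ)
open import Relation.Binary.PropositionalEquality using (_≡_; refl)
open import Relation.Unary using (Pred; _∈_; _≐_)

record LatinSquare (n : ℕ) : Set where
  field
    cell   : Fin n → Fin n → Fin n
    row    : ∀ x z → ∃! _≡_ (λ y → cell x y ≡ z)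
    column : ∀ y z → ∃! _≡_ (λ x → cell x y ≡ z)

Triple : ℕ → Set
Triple n = Vec (Fin n) 3

O : ∀ {n} → LatinSquare n → Pred (Triple n) 0ℓ
O L (x ∷ y ∷ z ∷ []) = LatinSquare.cell L x y ≡ z

-- Permutations act on the right: the image xβ is β ⟨$⟩ʳ x.

record Paratopism (n : ℕ) : Set where
  constructor ⟨_,_,_⨾_⟩
  field
    α β γ : Permutation′ n
    δ     : Permutation′ 3

[12] : Permutation′ 3
[12] = transpose zero (suc zero)

-- The i-th entry is moved by the i-th of α, β, γ and then placed at
-- position iδ; hence position j of the image comes from position jδ⁻¹.
act : ∀ {n} → Paratopism n → Triple n → Triple n
act ⟨ α , β , γ ⨾ δ ⟩ t = tabulate λ j →
  let i = δ ⟨$⟩ˡ j in Vec.lookup (α ∷ β ∷ γ ∷ []) i ⟨$⟩ʳ Vec.lookup t i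

act-[12] : ∀ {n} (α β γ : Permutation′ n) x y z →
           act ⟨ α , β , γ ⨾ [12] ⟩ (x ∷ y ∷ z ∷ []) ≡
           (β ⟨$⟩ʳ y) ∷ (α ⟨$⟩ʳ x) ∷ (γ ⟨$⟩ʳ z) ∷ []
act-[12] α β γ x y z = refl

-- The triple set of L^σ.
O^ : ∀ {n} → LatinSquare n → Paratopism n → Pred (Triple n) 0ℓ
O^ L σ u = ∃[ t ] (t ∈ O L × act σ t ≡ u)

-- A Latin square is determined by its triple set, so L^σ = L is expressed
-- as equality of triple sets.
IsAutoparatopism : ∀ {n} → Paratopism n → LatinSquare n → Set
IsAutoparatopism σ L = O^ L σ ≐ O L

Par : (n : ℕ) → Pred (Paratopism n) 0ℓ
Par n σ = ∃[ L ] IsAutoparatopism σ L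

next : ∀ {d} → Fin d → Fin d
next {suc d} j = suc (toℕ j) mod suc d

-- β is the product of disjoint cycles (c i 0, c i 1, …, c i (dᵢ − 1)), where
-- dᵢ is the i-th entry of ds and c i j = Inverse.to labelling (i , j).
-- Fixed points are listed as cycles of length 1.
record HasCycleStructure {n : ℕ} (β : Permutation′ n) (ds : List ℕ) : Set where
  field
    positive  : All (1 ≤_) ds
    labelling : (Σ[ i ∈ Fin (length ds) ] Fin (lookup ds i)) ↔ Fin n
    cyclic    : ∀ i j → β ⟨$⟩ʳ Inverse.to labelling (i , j)
                        ≡ Inverse.to labelling (i , next j)

{-# OPTIONS --safe #-}

-- Write C₁, C₂ for the cycles of lengths d₁ > d₂.
-- The symmetry reads L(yβ, x) = L(x, y)β, so L(xβᵐ, yβᵐ) = L(x, y)β²ᵐ for all m.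
-- For x in C₁ and y in C₂ the choice m = d₂ forces L(x, y) into C₁ (otherwise
-- d₁ ∣ d₂), then m = d₁ gives d₂ ∣ d₁, and d₁ = 2hd₂ is refuted by m = hd₂.
-- Fix x in C₁. A symbol outside C₁ in row x sits in a column xβᶜ, and then column
-- xβ^(−1−c) holds a symbol of the same cycle. A fixed symbol thus lies at the
-- solution of 2c ≡ −1 (mod d₁), so d₁ and d₂ are odd, and c ↦ −1 − c induces a
-- fixed-point-free involution on the d₂ symbols of C₂, which is absurd.
-- Conversely, for odd d₁/d₂ a symmetric block of d₂ diagonals of the addition
-- table of ℤ/d₁ can be prolonged by the addition table of ℤ/d₂.
module Submission where

open import Defs
open import Data.Empty using (⊥)
open import Data.Fin.Base using (Fin; zero; suc; toℕ; fromℕ<; opposite; punchOut)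
open import Data.Fin.Permutation using (Permutation′; id; permutation; _⟨$⟩ʳ_; _⟨$⟩ˡ_; inverseˡ; inverseʳ)
open import Data.Fin.Properties as Fin using (any?; toℕ-injective; toℕ-fromℕ<; toℕ<n; punchOut-injective; injective⇒≤; opposite-prop; opposite-involutive)
open import Data.Integer.Base as ℤ using (ℤ; +_; 0ℤ; 1ℤ)
open import Data.Integer.Divisibility.Signed as ℤ∣ using (divides; ∣⇒∣ᵤ; ∣ᵤ⇒∣; ∣m∣n⇒∣m+n; ∣m∣n⇒∣m-n; ∣m⇒∣-m)
open import Data.Integer.DivMod using (_%ℕ_; _/ℕ_; n%ℕd<d; a≡a%ℕn+[a/ℕn]*n)
import Data.Integer.Properties as ℤ
open import Data.Integer.Tactic.RingSolver using (solve-∀)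
open import Data.List.Base using ([]; _∷_; replicate; lookup; length)
open import Data.List.Properties using (length-replicate)
open import Data.Nat.Base using (ℕ; zero; suc; _+_; _*_; _<_; _>_; parity; NonZero)
open import Data.Nat.Divisibility as ℕ∣ using (_∣_; >⇒∤)
import Data.Nat.Properties as ℕ
open import Data.Parity.Base as ℙ using (0ℙ; 1ℙ)
import Data.Parity.Properties as ℙ
open import Data.Product using (Σ-syntax; _×_; _,_; proj₁; proj₂; ∃-syntax; ∃!)
open import Data.Sum.Base using (_⊎_; inj₁; inj₂)
open import Data.Vec.Base using ([]; _∷_)
open import Function.Base using (_∘_)
open import Function.Bundles using (_⇔_; mk⇔; Inverse)
open import Function.Definitions using (Injective)
open import Relation.Binary.PropositionalEquality
open import Relation.Nullary using (¬_; Dec; yes; no; contradiction)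
open import Relation.Nullary.Decidable using (map′)
open import Relation.Unary using (_∈_)
open import Algebra.Properties.CommutativeMonoid.Sum ℕ.+-0-commutativeMonoid using (sum; sum-permute; ∑-distrib-+; sum-cong-≗)

-- Injections of finite sets, parity, and involutions.

injective⇒surjective : ∀ {n} {g : Fin n → Fin n} → Injective _≡_ _≡_ g → ∀ z → ∃[ y ] g y ≡ z
injective⇒surjective {suc n} {g} inj z with any? (λ y → g y Fin.≟ z)
... | yes hit = hit
-- Pigeonhole: punching the missed value out of the codomain would inject `Fin (suc n)` into
-- `Fin n`.
... | no miss = contradiction (injective⇒≤ avoid-inj) ℕ.1+n≰n
  where
  z≢g : ∀ y → ¬ z ≡ g y
  z≢g y z≡gy = miss (y , sym z≡gy)
  avoid : Fin (suc n) → Fin n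
  avoid y = punchOut (z≢g y)
  avoid-inj : Injective _≡_ _≡_ avoid
  avoid-inj {y} {y′} eq = inj (punchOut-injective (z≢g y) (z≢g y′) eq)

injective⇒∃! : ∀ {n} {g : Fin n → Fin n} → Injective _≡_ _≡_ g → ∀ z → ∃! _≡_ (λ y → g y ≡ z)
injective⇒∃! inj z with injective⇒surjective inj z
... | y , gy≡z = y , gy≡z , λ gy′≡z → inj (trans gy≡z (sym gy′≡z))

even-parity : ∀ m → parity (m + m) ≡ 0ℙ
even-parity m = trans (ℙ.+-homo-+ m m) (ℙ.p+p≡0ℙ (parity m))

odd-parity : ∀ m → parity (1 + (m + m)) ≡ 1ℙ
odd-parity m = trans (ℙ.+-homo-+ 1 (m + m)) (cong (1ℙ ℙ.+_) (even-parity m))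

even-half : ∀ m → parity m ≡ 0ℙ → ∃[ h ] m ≡ h + h
even-half zero          _ = 0 , refl
even-half (suc (suc m)) p with even-half m p
... | h , refl = suc h , cong suc (sym (ℕ.+-suc h h))

odd-half : ∀ m → parity m ≡ 1ℙ → ∃[ h ] m ≡ 1 + (h + h)
odd-half (suc zero)    _ = 0 , refl
odd-half (suc (suc m)) p with odd-half m p
... | h , refl = suc h , cong (λ t → suc (suc t)) (sym (ℕ.+-suc h h))

sum-ones : ∀ m → sum {m} (λ _ → 1) ≡ m
sum-ones zero    = refl
sum-ones (suc m) = cong suc (sum-ones m)

private
  ascent : ℕ → ℕ → ℕ
  ascent a b with a ℕ.<? b
  ... | yes _ = 1
  ... | no _  = 0

  ascent-swap : ∀ a b → ¬ a ≡ b → ascent a b + ascent b a ≡ 1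
  ascent-swap a b a≢b with a ℕ.<? b | b ℕ.<? a
  ... | yes a<b | yes b<a = contradiction b<a (ℕ.<-asym a<b)
  ... | yes _   | no _    = refl
  ... | no _    | yes _   = refl
  ... | no a≮b  | no b≮a  = contradiction (ℕ.≤-antisym (ℕ.≮⇒≥ b≮a) (ℕ.≮⇒≥ a≮b)) a≢b

-- The points with j < ι j are exchanged by ι with those with ι j < j.
fixedPointFreeInvolution⇒even : ∀ {m} (ι : Fin m → Fin m) → (∀ j → ι (ι j) ≡ j) →
                                (∀ j → ¬ ι j ≡ j) → parity m ≡ 0ℙ
fixedPointFreeInvolution⇒even {m} ι invol free = trans (cong parity m≡ups+ups) (even-parity (sum ups))
  where
  ups downs : Fin m → ℕ
  ups j   = ascent (toℕ j) (toℕ (ι j))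
  downs j = ascent (toℕ (ι j)) (toℕ j)
  π : Permutation′ m
  π = permutation ι ι invol invol
  open ≡-Reasoning
  m≡ups+ups : m ≡ sum ups + sum ups
  m≡ups+ups = begin
    m                           ≡⟨ sum-ones m ⟨
    sum {m} (λ _ → 1)           ≡⟨ sum-cong-≗ (λ j → ascent-swap _ _ (λ eq → free j (sym (toℕ-injective eq)))) ⟨
    sum (λ j → ups j + downs j) ≡⟨ ∑-distrib-+ ups downs ⟩
    sum ups + sum downs         ≡⟨ cong (_+_ (sum ups)) (sum-cong-≗ (λ j → cong (ascent (toℕ (ι j))) (cong toℕ (invol j)))) ⟨
    sum ups + sum (ups ∘ ι)     ≡⟨ cong (_+_ (sum ups)) (sum-permute ups π) ⟨
    sum ups + sum ups           ∎

-- Residue classes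

infix 4 _≋_[mod_]

-- A record rather than a bare divisibility, so that unification can recover `a` and `b`, which the
-- computed difference would hide.
record _≋_[mod_] (a b : ℤ) (d : ℕ) : Set where
  constructor difference
  field divisible : + d ℤ∣.∣ a ℤ.- b

open _≋_[mod_]

⟦_⟧ : ∀ {d} → Fin d → ℤ
⟦ j ⟧ = + toℕ j

-- Reduces a congruence to a known one through an identity of differences, usually left to the ring
-- solver.
mod-by : ∀ {d a b a₁ b₁} → a ℤ.- b ≡ a₁ ℤ.- b₁ → a₁ ≋ b₁ [mod d ] → a ≋ b [mod d ]
mod-by {d} eq (difference p) = difference (subst (+ d ℤ∣.∣_) (sym eq) p)

mod-by₂ : ∀ {d a b a₁ b₁ a₂ b₂} → a ℤ.- b ≡ (a₁ ℤ.- b₁) ℤ.+ (a₂ ℤ.- b₂) →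
          a₁ ≋ b₁ [mod d ] → a₂ ≋ b₂ [mod d ] → a ≋ b [mod d ]
mod-by₂ {d} eq (difference p) (difference q) = difference (subst (+ d ℤ∣.∣_) (sym eq) (∣m∣n⇒∣m+n p q))

mod-sym : ∀ {d a b} → a ≋ b [mod d ] → b ≋ a [mod d ]
mod-sym {d} {a} {b} (difference p) = difference (subst (+ d ℤ∣.∣_) (ident a b) (∣m⇒∣-m p))
  where
  ident : ∀ a b → ℤ.- (a ℤ.- b) ≡ b ℤ.- a
  ident = solve-∀

mod-trans : ∀ {d a b c} → a ≋ b [mod d ] → b ≋ c [mod d ] → a ≋ c [mod d ]
mod-trans {d} {a} {b} {c} = mod-by₂ (ident a b c)
  where
  ident : ∀ a b c → a ℤ.- c ≡ (a ℤ.- b) ℤ.+ (b ℤ.- c)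
  ident = solve-∀

-- Two representatives in [0, d) differ by less than d in absolute value, and the only such multiple
-- of d is 0.
⟦⟧-injective-mod : ∀ {d} {i j : Fin d} → ⟦ i ⟧ ≋ ⟦ j ⟧ [mod d ] → i ≡ j
⟦⟧-injective-mod {d} {i} {j} p = toℕ-injective (ℤ.+-injective (ℤ.i-j≡0⇒i≡j ⟦ i ⟧ ⟦ j ⟧ (ℤ.∣i∣≡0⇒i≡0 (small bound (∣⇒∣ᵤ (divisible p))))))
  where
  bound : ℤ.∣ ⟦ i ⟧ ℤ.- ⟦ j ⟧ ∣ < d
  bound rewrite ℤ.m-n≡m⊖n (toℕ i) (toℕ j) =
    ℕ.≤-<-trans (ℤ.∣m⊝n∣≤m⊔n (toℕ i) (toℕ j)) (ℕ.⊔-lub (toℕ<n i) (toℕ<n j))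
  small : ∀ {m} → m < d → d ∣ m → m ≡ 0
  small {zero}  _   _   = refl
  small {suc m} m<d d∣m = contradiction d∣m (>⇒∤ m<d)

abstract
  -- Abstract, so that integer remainders never unfold: later arguments see only `res-spec` and
  -- `next-res`.
  res : ∀ d .{{_ : NonZero d}} → ℤ → Fin d
  res d a = fromℕ< (n%ℕd<d a d)

  res-spec : ∀ d .{{_ : NonZero d}} a → a ≋ ⟦ res d a ⟧ [mod d ]
  res-spec d a = difference (divides (a /ℕ d) (begin
    a ℤ.- ⟦ res d a ⟧               ≡⟨ cong (λ r → a ℤ.- + r) (toℕ-fromℕ< (n%ℕd<d a d)) ⟩
    a ℤ.- + (a %ℕ d)                ≡⟨ cong (ℤ._- + (a %ℕ d)) (a≡a%ℕn+[a/ℕn]*n a d) ⟩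
    (+ (a %ℕ d) ℤ.+ a /ℕ d ℤ.* + d) ℤ.- + (a %ℕ d) ≡⟨ ident (+ (a %ℕ d)) (a /ℕ d ℤ.* + d) ⟩
    a /ℕ d ℤ.* + d                  ∎))
    where
    open ≡-Reasoning
    ident : ∀ r t → (r ℤ.+ t) ℤ.- r ≡ t
    ident = solve-∀

  next-res : ∀ {d} .{{_ : NonZero d}} (j : Fin d) → next j ≡ res d (1ℤ ℤ.+ ⟦ j ⟧)
  next-res {suc d} j = refl

res-cong : ∀ {d} .{{_ : NonZero d}} {a b} → a ≋ b [mod d ] → res d a ≡ res d b
res-cong {d} {a} {b} p = ⟦⟧-injective-mod (mod-trans (mod-sym (res-spec d a)) (mod-trans p (res-spec d b)))

res-injective : ∀ {d} .{{_ : NonZero d}} {a b} → res d a ≡ res d b → a ≋ b [mod d ]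
res-injective {d} {a} {b} eq =
  mod-trans (subst (λ r → a ≋ ⟦ r ⟧ [mod d ]) eq (res-spec d a)) (mod-sym (res-spec d b))

res-⟦⟧ : ∀ {d} .{{_ : NonZero d}} (j : Fin d) → res d ⟦ j ⟧ ≡ j
res-⟦⟧ {d} j = ⟦⟧-injective-mod (mod-sym (res-spec d ⟦ j ⟧))

-- Identifies `opposite` with the map j ↦ -1 - j modulo d.
opposite-toℕ : ∀ {d} (j : Fin d) → d ≡ 1 + (toℕ j + toℕ (opposite j))
opposite-toℕ {d} j = sym (trans (cong (_+_ (suc (toℕ j))) (opposite-prop j)) (ℕ.m+[n∸m]≡n (toℕ<n j)))

-- Advances m steps along the cycle; matching on `suc d` supplies the `NonZero` instance for `res`.
_⊕_ : ∀ {d} → Fin d → ℕ → Fin d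
_⊕_ {suc d} j m = res (suc d) (+ m ℤ.+ ⟦ j ⟧)

⊕-zero : ∀ {d} (j : Fin d) → j ⊕ 0 ≡ j
⊕-zero {suc d} j = res-⟦⟧ j

next-⊕ : ∀ {d} (j : Fin d) → next j ≡ j ⊕ 1
next-⊕ {suc d} = next-res

⊕-⊕ : ∀ {d} (j : Fin d) a b → (j ⊕ a) ⊕ b ≡ j ⊕ (b + a)
⊕-⊕ {suc d} j a b = res-cong (mod-by (ident (+ a) (+ b) ⟦ j ⟧ ⟦ j ⊕ a ⟧) (mod-sym (res-spec (suc d) (+ a ℤ.+ ⟦ j ⟧))))
  where
  ident : ∀ a b j r → (b ℤ.+ r) ℤ.- ((b ℤ.+ a) ℤ.+ j) ≡ r ℤ.- (a ℤ.+ j)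
  ident = solve-∀

⊕-mod : ∀ {d} (j : Fin d) m → ⟦ j ⊕ m ⟧ ≋ + m ℤ.+ ⟦ j ⟧ [mod d ]
⊕-mod {suc d} j m = mod-sym (res-spec (suc d) (+ m ℤ.+ ⟦ j ⟧))

res-⊕ : ∀ d .{{_ : NonZero d}} a m → res d a ⊕ m ≡ res d (+ m ℤ.+ a)
res-⊕ d a m = ⟦⟧-injective-mod (mod-trans (⊕-mod (res d a) m)
  (mod-trans (mod-by (ident (+ m) a ⟦ res d a ⟧) (mod-sym (res-spec d a))) (res-spec d (+ m ℤ.+ a))))
  where
  ident : ∀ m a r → (m ℤ.+ r) ℤ.- (m ℤ.+ a) ≡ r ℤ.- a
  ident = solve-∀

⊕-period : ∀ {d} (j : Fin d) {m} → d ∣ m → j ⊕ m ≡ j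
⊕-period {suc d} j {m} d∣m = trans (res-cong (difference (subst (+ suc d ℤ∣.∣_) (ident (+ m) ⟦ j ⟧) (∣ᵤ⇒∣ d∣m)))) (res-⟦⟧ j)
  where
  ident : ∀ m j → m ≡ (m ℤ.+ j) ℤ.- j
  ident = solve-∀

⊕-fixed⇒∣ : ∀ {d} (j : Fin d) {m} → j ⊕ m ≡ j → d ∣ m
⊕-fixed⇒∣ {suc d} j {m} eq =
  ∣⇒∣ᵤ (subst (+ suc d ℤ∣.∣_) (ident (+ m) ⟦ j ⟧) (divisible (res-injective (trans eq (sym (res-⟦⟧ j))))))
  where
  ident : ∀ m j → (m ℤ.+ j) ℤ.- j ≡ m
  ident = solve-∀

0⊕toℕ : ∀ {d} (j : Fin (suc d)) → zero ⊕ toℕ j ≡ j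
0⊕toℕ {d} j = trans (cong (res (suc d)) (ℤ.+-identityʳ ⟦ j ⟧)) (res-⟦⟧ j)

self-opposite : ∀ {d} {j : Fin d} → opposite j ≡ j → d ≡ 1 + (toℕ j + toℕ j)
self-opposite {d} {j} eq = trans (opposite-toℕ j) (cong (λ i → 1 + (toℕ j + toℕ i)) eq)

self-opposite-unique : ∀ {d} {i j : Fin d} → opposite i ≡ i → opposite j ≡ j → i ≡ j
self-opposite-unique {i = i} {j} oi oj = toℕ-injective (halve (toℕ i) (toℕ j) (ℕ.suc-injective (trans (sym (self-opposite oi)) (self-opposite oj))))
  where
  halve : ∀ a b → a + a ≡ b + b → a ≡ b
  halve a b eq = ℕ.*-cancelˡ-≡ a b 2 (trans (double a) (trans eq (sym (double b))))
    where
    double : ∀ c → 2 * c ≡ c + c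
    double c = cong (_+_ c) (ℕ.+-identityʳ c)

-- Disjoint unions of cycles, their shifts, and compatible squares.

lookup-ones : ∀ f (i : Fin (length (replicate f 1))) → lookup (replicate f 1) i ≡ 1
lookup-ones (suc f) zero    = refl
lookup-ones (suc f) (suc i) = lookup-ones f i

module Shifts {I : Set} (len : I → ℕ) where

  Point : Set
  Point = Σ[ i ∈ I ] Fin (len i)

  period : Point → ℕ
  period (i , _) = len i

  shift : ℕ → Point → Point
  shift m (i , j) = i , j ⊕ m

  shift-zero : ∀ p → shift 0 p ≡ p
  shift-zero (i , j) = cong (i ,_) (⊕-zero j)

  shift-shift : ∀ p a b → shift b (shift a p) ≡ shift (b + a) p
  shift-shift (i , j) a b = cong (i ,_) (⊕-⊕ j a b)

  snd-injective : ∀ {i} {j k : Fin (len i)} → _≡_ {A = Point} (i , j) (i , k) → j ≡ k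
  -- The match deletes the equation i = i, so it relies on axiom K.
  snd-injective refl = refl

  shift-period : ∀ p {m} → period p ∣ m → shift m p ≡ p
  shift-period (i , j) d∣m = cong (i ,_) (⊕-period j d∣m)

  shift-fixed⇒∣ : ∀ p {m} → shift m p ≡ p → period p ∣ m
  shift-fixed⇒∣ (i , j) eq = ⊕-fixed⇒∣ j (snd-injective eq)

  -- The Latin square in cycle coordinates, where β becomes `shift 1`; `cell-shift` is L(yβ, x) =
  -- L(x, y)β.
  record ShiftSquare : Set where
    field
      cell             : Point → Point → Point
      cell-shift       : ∀ p q → cell (shift 1 q) p ≡ shift 1 (cell p q)
      row-injective    : ∀ {p q q′} → cell p q ≡ cell p q′ → q ≡ q′
      column-injective : ∀ {p p′ q} → cell p q ≡ cell p′ q → p ≡ p′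
      row-surjective   : ∀ p z → ∃[ q ] cell p q ≡ z

    -- Two applications of the symmetry transpose twice, so they shift row and column once and the
    -- symbol twice.
    cell-shift-double : ∀ m p q → cell (shift m p) (shift m q) ≡ shift (m + m) (cell p q)
    cell-shift-double zero    p q = trans (cong₂ cell (shift-zero p) (shift-zero q)) (sym (shift-zero (cell p q)))
    cell-shift-double (suc m) p q = begin
      cell (shift (1 + m) p) (shift (1 + m) q)         ≡⟨ cong₂ cell (shift-shift p m 1) (shift-shift q m 1) ⟨
      cell (shift 1 (shift m p)) (shift 1 (shift m q)) ≡⟨ cell-shift (shift 1 (shift m q)) (shift m p) ⟩
      shift 1 (cell (shift 1 (shift m q)) (shift m p)) ≡⟨ cong (shift 1) (cell-shift (shift m p) (shift m q)) ⟩
      shift 1 (shift 1 (cell (shift m p) (shift m q))) ≡⟨ shift-shift _ 1 1 ⟩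
      shift 2 (cell (shift m p) (shift m q))           ≡⟨ cong (shift 2) (cell-shift-double m p q) ⟩
      shift 2 (shift (m + m) (cell p q))               ≡⟨ shift-shift _ (m + m) 2 ⟩
      shift (2 + (m + m)) (cell p q)                   ≡⟨ cong (λ t → shift (suc t) (cell p q)) (ℕ.+-suc m m) ⟨
      shift (suc m + suc m) (cell p q)                 ∎
      where open ≡-Reasoning

    -- If m fixes the column and 2m the symbol, then rows `p` and `shift m p` hold the same symbol
    -- in column `q`, hence coincide. `column-period` is the transposed argument.
    row-period : ∀ {p q z} m → cell p q ≡ z → period q ∣ m → period z ∣ m + m → period p ∣ m
    row-period {p} {q} m refl q∣m z∣2m = shift-fixed⇒∣ p (column-injective
      (trans (cong (cell (shift m p)) (sym (shift-period q q∣m)))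
      (trans (cell-shift-double m p q) (shift-period _ z∣2m))))

    column-period : ∀ {p q z} m → cell p q ≡ z → period p ∣ m → period z ∣ m + m → period q ∣ m
    column-period {p} {q} m refl p∣m z∣2m = shift-fixed⇒∣ q (row-injective
      (trans (cong (λ r → cell r (shift m q)) (sym (shift-period p p∣m)))
      (trans (cell-shift-double m p q) (shift-period _ z∣2m))))

-- Necessity: odd quotient and absence of fixed points.

module Necessity (e₁ e₂ f : ℕ) (d₁>d₂ : suc e₁ > suc e₂)
                 (S : Shifts.ShiftSquare (lookup (suc e₁ ∷ suc e₂ ∷ replicate f 1))) where
  open Shifts (lookup (suc e₁ ∷ suc e₂ ∷ replicate f 1))
  open ShiftSquare S

  private
    d₁ d₂ : ℕ
    d₁ = suc e₁
    d₂ = suc e₂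

    pattern long j = zero , j
    pattern short j = suc zero , j

  d₁∤d₂ : ¬ d₁ ∣ d₂
  d₁∤d₂ = >⇒∤ d₁>d₂

  tail-period : ∀ i → lookup (d₂ ∷ replicate f 1) i ∣ d₂
  tail-period zero    = ℕ∣.∣-refl
  tail-period (suc i) = subst (_∣ d₂) (sym (lookup-ones f i)) (ℕ∣.1∣ d₂)

  -- Column and symbol both outside C₁ would have periods dividing d₂, and `row-period` at m = d₂
  -- would give d₁ ∣ d₂. This serves both to locate columns (`long-column`) and to locate symbols
  -- (`long-short`).
  long-cell : ∀ {j q i k} → ¬ cell (long j) q ≡ (suc i , k) ⊎ (∃[ c ] q ≡ long c)
  long-cell {q = long c} = inj₂ (c , refl)
  long-cell {q = suc i′ , _} {i} = inj₁ λ eq → d₁∤d₂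
    (row-period d₂ eq (tail-period i′) (ℕ∣.∣m∣n⇒∣m+n (tail-period i) (tail-period i)))

  long-column : ∀ j i k → ∃[ c ] cell (long j) (long c) ≡ (suc i , k)
  long-column j i k with row-surjective (long j) (suc i , k)
  ... | q , eq with long-cell {j} {q} {i} {k}
  ...   | inj₁ neq        = contradiction eq neq
  ...   | inj₂ (c , refl) = c , eq

  long-short : ∀ j k → ∃[ l ] cell (long j) (short k) ≡ long l
  long-short j k = from-long (cell (long j) (short k)) refl
    where
    from-long : ∀ z → cell (long j) (short k) ≡ z → ∃[ l ] cell (long j) (short k) ≡ long l
    from-long (long l)    eq = l , eq
    from-long (suc i , l) eq with long-cell {j} {short k} {i} {l}
    ... | inj₁ neq = contradiction eq neq

  d₂∣d₁ : d₂ ∣ d₁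
  d₂∣d₁ = column-period d₁ (proj₂ (long-short zero zero)) ℕ∣.∣-refl (ℕ∣.∣m∣n⇒∣m+n ℕ∣.∣-refl ℕ∣.∣-refl)

  odd-quotient : ∀ k → d₁ ≡ k * d₂ → parity k ≡ 1ℙ
  odd-quotient k d₁≡kd₂ with parity k in eq
  ... | 1ℙ = refl
  ... | 0ℙ with even-half k eq
  ...   | zero  , refl = contradiction d₁≡kd₂ λ ()
  -- Now d₁ = 2m for m = `hd₂`: shifting by m fixes a column in C₂, shifting by 2m fixes its symbol
  -- in C₁, so d₁ would divide m < d₁.
  ...   | suc h , refl = contradiction d₁∣hd₂ (>⇒∤ hd₂<d₁)
    where
    hd₂ : ℕ
    hd₂ = suc h * d₂
    d₁≡hd₂+hd₂ : d₁ ≡ hd₂ + hd₂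
    d₁≡hd₂+hd₂ = trans d₁≡kd₂ (ℕ.*-distribʳ-+ d₂ (suc h) (suc h))
    hd₂<d₁ : hd₂ < d₁
    hd₂<d₁ = subst (hd₂ <_) (sym d₁≡hd₂+hd₂) (ℕ.m<m+n hd₂ ℕ.0<1+n)
    d₁∣hd₂ : d₁ ∣ hd₂
    d₁∣hd₂ = row-period hd₂ (proj₂ (long-short zero zero)) (ℕ∣.divides (suc h) refl) (ℕ∣.∣-reflexive d₁≡hd₂+hd₂)

  -- The symmetry sends the cell (0, c) to (c + 1, 0), and a further shift by
  -- −(c + 1) = opposite c brings it back into row 0.
  mirror : ∀ {c z} → cell (long zero) (long c) ≡ z →
           cell (long zero) (long (opposite c)) ≡ shift (toℕ (opposite c) + toℕ (opposite c) + 1) z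
  mirror {c} {z} refl = begin
    cell (long zero) (long c′)                          ≡⟨ cong₂ (λ i j → cell (long i) (long j)) row-back (0⊕toℕ c′) ⟨
    cell (shift m (shift 1 (long c))) (shift m (long zero)) ≡⟨ cell-shift-double m _ _ ⟩
    shift (m + m) (cell (shift 1 (long c)) (long zero)) ≡⟨ cong (shift (m + m)) (cell-shift (long zero) (long c)) ⟩
    shift (m + m) (shift 1 z)                           ≡⟨ shift-shift z 1 (m + m) ⟩
    shift (m + m + 1) z                                 ∎
    where
    open ≡-Reasoning
    c′ : Fin d₁
    c′ = opposite c
    m : ℕ
    m = toℕ c′
    row-back : (c ⊕ 1) ⊕ m ≡ zero
    row-back = begin
      (c ⊕ 1) ⊕ m              ≡⟨ cong (λ j → (j ⊕ 1) ⊕ m) (0⊕toℕ c) ⟨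
      ((zero ⊕ toℕ c) ⊕ 1) ⊕ m ≡⟨ ⊕-⊕ (zero ⊕ toℕ c) 1 m ⟩
      (zero ⊕ toℕ c) ⊕ (m + 1) ≡⟨ ⊕-⊕ zero (toℕ c) (m + 1) ⟩
      zero ⊕ (m + 1 + toℕ c)   ≡⟨ ⊕-period zero (ℕ∣.∣-reflexive (trans (opposite-toℕ c) (rearr (toℕ c) m))) ⟩
      zero                     ∎
      where
      rearr : ∀ a b → 1 + (a + b) ≡ b + 1 + a
      rearr a b = trans (cong suc (ℕ.+-comm a b)) (cong (_+ a) (ℕ.+-comm 1 b))

  module FixedPoint (i : Fin (length (replicate f 1))) where
    -- The length at this index equals 1 only propositionally, hence the transport.
    fixedPoint : Point
    fixedPoint = suc (suc i) , subst Fin (sym (lookup-ones f i)) zero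

    period-divides : ∀ m → period fixedPoint ∣ m
    period-divides m = subst (_∣ m) (sym (lookup-ones f i)) (ℕ∣.1∣ m)

    private
      column-of-fixed : ∃[ c ] cell (long zero) (long c) ≡ fixedPoint
      column-of-fixed = long-column zero (suc i) _

      c₀ : Fin d₁
      c₀ = proj₁ column-of-fixed

    -- Every shift preserves a fixed symbol, so the mirrored column holds the same symbol and must
    -- be the same column.
    self-opposite-c₀ : opposite c₀ ≡ c₀
    self-opposite-c₀ = snd-injective (row-injective (trans (mirror (proj₂ column-of-fixed))
      (trans (shift-period fixedPoint (period-divides _))
      (sym (proj₂ column-of-fixed)))))

    odd-d₁ : parity d₁ ≡ 1ℙ
    odd-d₁ = trans (cong parity (self-opposite self-opposite-c₀)) (odd-parity (toℕ c₀))

    odd-d₂ : parity d₂ ≡ 1ℙ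
    odd-d₂ with d₂∣d₁
    ... | ℕ∣.divides k eq with parity d₂ in eq₂
    ...   | 1ℙ = refl
    ...   | 0ℙ = contradiction (trans (sym odd-d₁) (trans (cong parity eq)
                   (trans (ℙ.*-homo-* k d₂) (trans (cong (parity k ℙ.*_) eq₂) (ℙ.*-zeroʳ (parity k)))))) λ ()

    col : Fin d₂ → Fin d₁
    col j = proj₁ (long-column zero zero j)

    col-cell : ∀ j → cell (long zero) (long (col j)) ≡ short j
    col-cell j = proj₂ (long-column zero zero j)

    col-unique : ∀ {c j} → cell (long zero) (long c) ≡ short j → col j ≡ c
    col-unique eq = snd-injective (row-injective (trans (col-cell _) (sym eq)))

    -- The symbol that `mirror` places in the column opposite to that of `j`; thus `col` carries `ι`
    -- to `opposite`.
    ι : Fin d₂ → Fin d₂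
    ι j = j ⊕ (toℕ (opposite (col j)) + toℕ (opposite (col j)) + 1)

    col-ι : ∀ j → col (ι j) ≡ opposite (col j)
    col-ι j = col-unique (mirror (col-cell j))

    ι-involutive : ∀ j → ι (ι j) ≡ j
    ι-involutive j = snd-injective (begin
      short (ι (ι j))                          ≡⟨ col-cell (ι (ι j)) ⟨
      cell (long zero) (long (col (ι (ι j)))) ≡⟨ cong (λ c → cell (long zero) (long c)) col-ι-ι ⟩
      cell (long zero) (long (col j))          ≡⟨ col-cell j ⟩
      short j                                  ∎)
      where
      open ≡-Reasoning
      col-ι-ι : col (ι (ι j)) ≡ col j
      col-ι-ι = trans (col-ι (ι j)) (trans (cong opposite (col-ι j)) (opposite-involutive (col j)))

    -- A fixed `j` would lie in a self-opposite column. The only one is `c₀`, already occupied by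
    -- the fixed symbol.
    ι-free : ∀ j → ¬ ι j ≡ j
    ι-free j eq = contradiction (trans (sym (col-cell j)) (trans (cong (λ c → cell (long zero) (long c)) col≡c₀) (proj₂ column-of-fixed))) λ ()
      where
      col≡c₀ : col j ≡ c₀
      col≡c₀ = self-opposite-unique (trans (sym (col-ι j)) (cong col eq)) self-opposite-c₀

    impossible : ⊥
    impossible = contradiction (trans (sym odd-d₂) (fixedPointFreeInvolution⇒even ι ι-involutive ι-free)) λ ()

  no-fixed-points : f ≡ 0
  no-fixed-points = trans (sym (length-replicate f)) (empty FixedPoint.impossible)
    where
    empty : ∀ {m} → (Fin m → ⊥) → m ≡ 0
    empty {zero}  _ = refl
    empty {suc m} g = contradiction (g zero) λ ()

-- Passage between labels and cycle coordinates.

module Transfer {n ds} {β : Permutation′ n} (H : HasCycleStructure β ds) where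
  open HasCycleStructure H
  open Shifts (lookup ds)

  private
    to : Point → Fin n
    to = Inverse.to labelling
    from : Fin n → Point
    from = Inverse.from labelling

    to-from : ∀ x → to (from x) ≡ x
    to-from x = Inverse.inverseˡ labelling refl
    from-to : ∀ p → from (to p) ≡ p
    from-to p = Inverse.inverseʳ labelling refl

    from-injective : ∀ {x y} → from x ≡ from y → x ≡ y
    from-injective {x} {y} eq = trans (sym (to-from x)) (trans (cong to eq) (to-from y))
    to-injective : ∀ {p q} → to p ≡ to q → p ≡ q
    to-injective {p} {q} eq = trans (sym (from-to p)) (trans (cong from eq) (from-to q))

    β-injective : ∀ {x y} → β ⟨$⟩ʳ x ≡ β ⟨$⟩ʳ y → x ≡ y
    β-injective {x} {y} eq = trans (sym (inverseˡ β)) (trans (cong (β ⟨$⟩ˡ_) eq) (inverseˡ β))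

    β-to : ∀ p → β ⟨$⟩ʳ to p ≡ to (shift 1 p)
    β-to (i , j) = trans (cyclic i j) (cong (λ k → to (i , k)) (next-⊕ j))

    from-β : ∀ x → from (β ⟨$⟩ʳ x) ≡ shift 1 (from x)
    from-β x = trans (cong (λ y → from (β ⟨$⟩ʳ y)) (sym (to-from x))) (trans (cong from (β-to (from x))) (from-to _))

  Par⇒ShiftSquare : ⟨ id , β , β ⨾ [12] ⟩ ∈ Par n → ShiftSquare
  Par⇒ShiftSquare (L , O^⊆O , _) = record
    { cell             = λ p q → from (cell (to p) (to q))
    ; cell-shift       = λ p q → trans
        (cong from (trans (cong (λ x → cell x (to p)) (sym (β-to q))) (symmetric (to p) (to q))))
        (from-β _)
    ; row-injective    = λ {p} eq → to-injective (∃!⇒unique (row (to p) _) (from-injective eq) refl)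
    ; column-injective = λ {_} {_} {q} eq → to-injective (∃!⇒unique (column (to q) _) (from-injective eq) refl)
    ; row-surjective   = surj
    }
    where
    open LatinSquare L
    symmetric : ∀ x y → cell (β ⟨$⟩ʳ y) x ≡ β ⟨$⟩ʳ cell x y
    -- The triple is the image of (x, y, L(x, y)); its membership in `O L` is by definition the
    -- required equation.
    symmetric x y = O^⊆O {(β ⟨$⟩ʳ y) ∷ x ∷ (β ⟨$⟩ʳ cell x y) ∷ []} ((x ∷ y ∷ cell x y ∷ []) , refl , refl)
    ∃!⇒unique : ∀ {P : Fin n → Set} → ∃! _≡_ P → ∀ {x y} → P x → P y → x ≡ y
    ∃!⇒unique (_ , _ , unique) px py = trans (sym (unique px)) (unique py)
    surj : ∀ p z → ∃[ q ] from (cell (to p) (to q)) ≡ z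
    surj p z with row (to p) (to z)
    ... | y , eq , _ = from y , trans (cong (λ v → from (cell (to p) v)) (to-from y)) (trans (cong from eq) (from-to z))

  -- The symmetry carries columns to rows, so only rows need to be injective.
  symmetricRows⇒Par : (c : Point → Point → Point) →
                      (∀ p q → c (shift 1 q) p ≡ shift 1 (c p q)) →
                      (∀ p {q q′} → c p q ≡ c p q′ → q ≡ q′) →
                      ⟨ id , β , β ⨾ [12] ⟩ ∈ Par n
  symmetricRows⇒Par c c-shift c-row = L , (λ {u} → O^⊆O {u}) , (λ {u} → O⊆O^ {u})
    where
    cell : Fin n → Fin n → Fin n
    cell x y = to (c (from x) (from y))

    symmetric : ∀ x y → cell (β ⟨$⟩ʳ y) x ≡ β ⟨$⟩ʳ cell x y
    symmetric x y = trans (cong (λ p → to (c p (from x))) (from-β y))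
      (trans (cong to (c-shift (from x) (from y))) (sym (β-to _)))

    row-injective : ∀ x → Injective _≡_ _≡_ (cell x)
    row-injective x eq = from-injective (c-row (from x) (to-injective eq))

    column-injective : ∀ y → Injective _≡_ _≡_ (λ x → cell x y)
    -- Applying β to the symbols of column y gives row yβ.
    column-injective y {x} {x′} eq = row-injective (β ⟨$⟩ʳ y)
      (trans (symmetric x y) (trans (cong (β ⟨$⟩ʳ_) eq) (sym (symmetric x′ y))))

    L : LatinSquare n
    L = record
      { cell   = cell
      ; row    = λ x → injective⇒∃! (row-injective x)
      ; column = λ y → injective⇒∃! (column-injective y)
      }

    O^⊆O : ∀ {u} → u ∈ O^ L ⟨ id , β , β ⨾ [12] ⟩ → u ∈ O L
    O^⊆O ((x ∷ y ∷ z ∷ []) , refl , refl) = symmetric x y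

    O⊆O^ : ∀ {u} → u ∈ O L → u ∈ O^ L ⟨ id , β , β ⨾ [12] ⟩
    O⊆O^ {x ∷ y ∷ z ∷ []} eq =
      -- The preimage of (x, y, z) is (y, xβ⁻¹, zβ⁻¹).
      (y ∷ (β ⟨$⟩ˡ x) ∷ (β ⟨$⟩ˡ z) ∷ []) , preimage , cong₂ (λ a b → a ∷ y ∷ b ∷ []) (inverseʳ β) (inverseʳ β)
      where
      preimage : cell y (β ⟨$⟩ˡ x) ≡ β ⟨$⟩ˡ z
      preimage = β-injective (trans (sym (symmetric y (β ⟨$⟩ˡ x)))
        (trans (cong (λ v → cell v y) (inverseʳ β)) (trans eq (sym (inverseʳ β)))))

-- Sufficiency: prolongation of an addition table.

-- On cycles of lengths N = (2h + 1) d and d, start from x + y mod N on the long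
-- cycle and x + y mod d on the short one. The cells of the long block whose difference
-- y − x lies in the middle interval [hd, hd + d), which c ↦ −1 − c maps to
-- itself, receive x + y mod d instead; the displaced symbols fill the mixed cells.
module Construction (d h : ℕ) {{_ : NonZero d}} where

  N : ℕ
  N = (1 + (h + h)) * d

  open Shifts (lookup (N ∷ d ∷ []))

  private
    pattern long j = zero , j
    pattern short j = suc zero , j

    instance
      N≢0 : NonZero N
      N≢0 = ℕ.m*n≢0 (1 + (h + h)) d

    H D : ℤ
    H = + h
    D = + d

    N≡ : + N ≡ (1ℤ ℤ.+ (H ℤ.+ H)) ℤ.* D
    N≡ = ℤ.pos-* (1 + (h + h)) d

    modN⇒modd : ∀ {a b} → a ≋ b [mod N ] → a ≋ b [mod d ]
    modN⇒modd (difference p) = difference (ℤ∣.∣-trans (divides (1ℤ ℤ.+ (H ℤ.+ H)) N≡) p)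

  base : ℤ
  base = H ℤ.* D

  Middle : ℤ → Set
  Middle a = Σ[ s ∈ Fin d ] a ≋ base ℤ.+ ⟦ s ⟧ [mod N ]

  middle? : ∀ a → Dec (Middle a)
  middle? a = any? λ s → map′ difference divisible (+ N ℤ∣.∣? (a ℤ.- (base ℤ.+ ⟦ s ⟧)))

  -- Since N = 2hd + d, -1 - (hd + s) ≡ hd + (d - 1 - s) modulo N: the offset s becomes its
  -- opposite.
  middle-mirror : ∀ {a b} → b ≋ ℤ.- 1ℤ ℤ.- a [mod N ] → Middle a → Middle b
  middle-mirror {a} b≋-1-a (s , a≋) = opposite s , mod-trans b≋-1-a (mod-by₂ eq (mod-sym a≋) 0≋N)
    where
    0≋N : 0ℤ ≋ + N [mod N ]
    0≋N = difference (subst (+ N ℤ∣.∣_) (sym (ℤ.+-identityˡ (ℤ.- + N))) (∣m⇒∣-m ℤ∣.∣-refl))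
    -- Here d is expanded as 1 + s + o, with o the opposite of s, which makes the claim a polynomial
    -- identity.
    ident : ∀ a h s o →
      (ℤ.- 1ℤ ℤ.- a) ℤ.- (h ℤ.* (1ℤ ℤ.+ (s ℤ.+ o)) ℤ.+ o) ≡
      ((h ℤ.* (1ℤ ℤ.+ (s ℤ.+ o)) ℤ.+ s) ℤ.- a) ℤ.+ (0ℤ ℤ.- (1ℤ ℤ.+ (h ℤ.+ h)) ℤ.* (1ℤ ℤ.+ (s ℤ.+ o)))
    ident = solve-∀
    D≡ : D ≡ 1ℤ ℤ.+ (⟦ s ⟧ ℤ.+ ⟦ opposite s ⟧)
    D≡ = cong +_ (opposite-toℕ s)
    eq : (ℤ.- 1ℤ ℤ.- a) ℤ.- (base ℤ.+ ⟦ opposite s ⟧) ≡ ((base ℤ.+ ⟦ s ⟧) ℤ.- a) ℤ.+ (0ℤ ℤ.- + N)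
    eq = subst (λ t → (ℤ.- 1ℤ ℤ.- a) ℤ.- (base ℤ.+ ⟦ opposite s ⟧) ≡ ((base ℤ.+ ⟦ s ⟧) ℤ.- a) ℤ.+ (0ℤ ℤ.- t)) (sym N≡)
      (subst (λ t → (ℤ.- 1ℤ ℤ.- a) ℤ.- (H ℤ.* t ℤ.+ ⟦ opposite s ⟧) ≡
                    ((H ℤ.* t ℤ.+ ⟦ s ⟧) ℤ.- a) ℤ.+ (0ℤ ℤ.- (1ℤ ℤ.+ (H ℤ.+ H)) ℤ.* t)) (sym D≡)
        (ident a H ⟦ s ⟧ ⟦ opposite s ⟧))

  -- The decision is an argument so that the lemmas below can split on the decisions of two cells
  -- independently.
  longCell : (x y : Fin N) → Dec (Middle (⟦ y ⟧ ℤ.- ⟦ x ⟧)) → Point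
  longCell x y (yes _) = short (res d (⟦ x ⟧ ℤ.+ ⟦ y ⟧))
  longCell x y (no _)  = long (res N (⟦ x ⟧ ℤ.+ ⟦ y ⟧))

  -- Row x loses the symbols x + (x + hd + s) with 0 ≤ s < d; this is the one congruent to x + y
  -- modulo d.
  mixedSymbol : ℤ → ℤ → ℤ
  mixedSymbol x y = x ℤ.+ x ℤ.+ (base ℤ.+ ⟦ res d (y ℤ.- x) ⟧)

  cell : Point → Point → Point
  cell (long x)  (long y)  = longCell x y (middle? (⟦ y ⟧ ℤ.- ⟦ x ⟧))
  cell (long x)  (short y) = long (res N (mixedSymbol ⟦ x ⟧ ⟦ y ⟧))
  -- Forced by the symmetry: L(y, x) = L(x, yβ⁻¹)β.
  cell (short y) (long x)  = long (res N (1ℤ ℤ.+ mixedSymbol ⟦ x ⟧ (⟦ y ⟧ ℤ.- 1ℤ)))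
  cell (short x) (short y) = short (res d (⟦ x ⟧ ℤ.+ ⟦ y ⟧))

  private
    sum-step : ∀ {m} (y : Fin m) x → ⟦ y ⊕ 1 ⟧ ℤ.+ x ≋ 1ℤ ℤ.+ (x ℤ.+ ⟦ y ⟧) [mod m ]
    sum-step y x = mod-by (ident x ⟦ y ⟧ ⟦ y ⊕ 1 ⟧) (⊕-mod y 1)
      where
      ident : ∀ x y Y → (Y ℤ.+ x) ℤ.- (1ℤ ℤ.+ (x ℤ.+ y)) ≡ Y ℤ.- (1ℤ ℤ.+ y)
      ident = solve-∀

  -- The symmetry turns the difference y - x into x - (y + 1) = -1 - (y - x), so by `middle-mirror`
  -- both cells are displaced or neither is.
  longCell-shift : ∀ x y D₁ D₂ → longCell (y ⊕ 1) x D₁ ≡ shift 1 (longCell x y D₂)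
  longCell-shift x y (yes _)  (yes _)  = cong (λ j → short j) (trans (res-cong (modN⇒modd (sum-step y ⟦ x ⟧))) (sym (res-⊕ d _ 1)))
  longCell-shift x y (no _)   (no _)   = cong (λ j → long j) (trans (res-cong (sum-step y ⟦ x ⟧)) (sym (res-⊕ N _ 1)))
  longCell-shift x y (no ¬m₁) (yes m₂) = contradiction (middle-mirror (mod-by (ident ⟦ x ⟧ ⟦ y ⟧ ⟦ y ⊕ 1 ⟧) (mod-sym (⊕-mod y 1))) m₂) ¬m₁
    where
    ident : ∀ x y Y → (x ℤ.- Y) ℤ.- (ℤ.- 1ℤ ℤ.- (y ℤ.- x)) ≡ (1ℤ ℤ.+ y) ℤ.- Y
    ident = solve-∀
  longCell-shift x y (yes m₁) (no ¬m₂) = contradiction (middle-mirror (mod-by (ident ⟦ x ⟧ ⟦ y ⟧ ⟦ y ⊕ 1 ⟧) (mod-sym (⊕-mod y 1))) m₁) ¬m₂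
    where
    ident : ∀ x y Y → (y ℤ.- x) ℤ.- (ℤ.- 1ℤ ℤ.- (x ℤ.- Y)) ≡ (1ℤ ℤ.+ y) ℤ.- Y
    ident = solve-∀

  cell-shift : ∀ p q → cell (shift 1 q) p ≡ shift 1 (cell p q)
  cell-shift (long x)  (long y)  = longCell-shift x y (middle? _) (middle? _)
  cell-shift (short x) (short y) = cong (λ j → short j) (trans (res-cong (sum-step y ⟦ x ⟧)) (sym (res-⊕ d _ 1)))
  cell-shift (long x)  (short y) = cong (λ j → long j) (trans
    (cong (λ r → res N (1ℤ ℤ.+ (⟦ x ⟧ ℤ.+ ⟦ x ⟧ ℤ.+ (base ℤ.+ ⟦ r ⟧))))
      (res-cong (mod-by (ident ⟦ x ⟧ ⟦ y ⟧ ⟦ y ⊕ 1 ⟧) (⊕-mod y 1))))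
    (sym (res-⊕ N _ 1)))
    where
    ident : ∀ x y Y → (Y ℤ.- 1ℤ ℤ.- x) ℤ.- (y ℤ.- x) ≡ Y ℤ.- (1ℤ ℤ.+ y)
    ident = solve-∀
  -- Passing to x + 1 adds 2 to 2x: one unit matches the 1 in the definition of the cell, the other
  -- the shift. The offset is unchanged, as y - (x + 1) = (y - 1) - x.
  cell-shift (short y) (long x)  = cong (λ j → long j) (trans
    (cong (λ r → res N (X ℤ.+ X ℤ.+ (base ℤ.+ ⟦ r ⟧)))
      (res-cong (mod-by (ident₁ ⟦ x ⟧ ⟦ y ⟧ X) (mod-sym (modN⇒modd (⊕-mod x 1))))))
    (trans (res-cong (mod-by₂ (ident₂ ⟦ x ⟧ X (base ℤ.+ ⟦ r ⟧)) (⊕-mod x 1) (⊕-mod x 1)))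
      (sym (res-⊕ N _ 1))))
    where
    X : ℤ
    X = ⟦ x ⊕ 1 ⟧
    r : Fin d
    r = res d (⟦ y ⟧ ℤ.- 1ℤ ℤ.- ⟦ x ⟧)
    ident₁ : ∀ x y X → (y ℤ.- X) ℤ.- (y ℤ.- 1ℤ ℤ.- x) ≡ (1ℤ ℤ.+ x) ℤ.- X
    ident₁ = solve-∀
    ident₂ : ∀ x X b → (X ℤ.+ X ℤ.+ b) ℤ.- (1ℤ ℤ.+ (1ℤ ℤ.+ (x ℤ.+ x ℤ.+ b))) ≡ (X ℤ.- (1ℤ ℤ.+ x)) ℤ.+ (X ℤ.- (1ℤ ℤ.+ x))
    ident₂ = solve-∀

  private
    cancelˡ : ∀ {m} c {a b} → c ℤ.+ a ≋ c ℤ.+ b [mod m ] → a ≋ b [mod m ]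
    cancelˡ c {a} {b} = mod-by (ident a b c)
      where
      ident : ∀ a b c → a ℤ.- b ≡ (c ℤ.+ a) ℤ.- (c ℤ.+ b)
      ident = solve-∀

    cancelʳ : ∀ {m} c {a b} → a ℤ.- c ≋ b ℤ.- c [mod m ] → a ≋ b [mod m ]
    cancelʳ c {a} {b} = mod-by (ident a b c)
      where
      ident : ∀ a b c → a ℤ.- b ≡ (a ℤ.- c) ℤ.- (b ℤ.- c)
      ident = solve-∀

    subʳ : ∀ {m} c {a b} → a ≋ b [mod m ] → a ℤ.- c ≋ b ℤ.- c [mod m ]
    subʳ c {a} {b} = mod-by (ident a b c)
      where
      ident : ∀ a b c → (a ℤ.- c) ℤ.- (b ℤ.- c) ≡ a ℤ.- b
      ident = solve-∀

    -- 2 is invertible modulo 2h + 1, with inverse −h.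
    halve-mod : ∀ {a b} → a ≋ b [mod d ] → a ℤ.+ a ≋ b ℤ.+ b [mod N ] → a ≋ b [mod N ]
    halve-mod {a} {b} (difference (divides q a-b≡qd)) (difference 2e) =
      difference (subst (+ N ℤ∣.∣_) combine (∣m∣n⇒∣m-n (divides q refl) (ℤ∣.∣n⇒∣m*n H 2e)))
      where
      open ≡-Reasoning
      ident₁ : ∀ q h d → q ℤ.* ((1ℤ ℤ.+ (h ℤ.+ h)) ℤ.* d) ≡ (1ℤ ℤ.+ (h ℤ.+ h)) ℤ.* (q ℤ.* d)
      ident₁ = solve-∀
      ident₂ : ∀ a b h → (1ℤ ℤ.+ (h ℤ.+ h)) ℤ.* (a ℤ.- b) ℤ.- h ℤ.* ((a ℤ.+ a) ℤ.- (b ℤ.+ b)) ≡ a ℤ.- b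
      ident₂ = solve-∀
      combine : q ℤ.* + N ℤ.- H ℤ.* ((a ℤ.+ a) ℤ.- (b ℤ.+ b)) ≡ a ℤ.- b
      combine = begin
        q ℤ.* + N ℤ.- t                                    ≡⟨ cong (λ v → q ℤ.* v ℤ.- t) N≡ ⟩
        q ℤ.* ((1ℤ ℤ.+ (H ℤ.+ H)) ℤ.* D) ℤ.- t             ≡⟨ cong (ℤ._- t) (ident₁ q H D) ⟩
        (1ℤ ℤ.+ (H ℤ.+ H)) ℤ.* (q ℤ.* D) ℤ.- t             ≡⟨ cong (λ v → (1ℤ ℤ.+ (H ℤ.+ H)) ℤ.* v ℤ.- t) a-b≡qd ⟨
        (1ℤ ℤ.+ (H ℤ.+ H)) ℤ.* (a ℤ.- b) ℤ.- t             ≡⟨ ident₂ a b H ⟩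
        a ℤ.- b                                            ∎
        where
        t : ℤ
        t = H ℤ.* ((a ℤ.+ a) ℤ.- (b ℤ.+ b))

    -- The middle interval has length d, so residues modulo d separate its elements.
    middle-injective : ∀ x {y y′ : Fin N} → Middle (⟦ y ⟧ ℤ.- x) → Middle (⟦ y′ ⟧ ℤ.- x) →
                       ⟦ y ⟧ ≋ ⟦ y′ ⟧ [mod d ] → y ≡ y′
    middle-injective x {y} {y′} (s , y≋) (s′ , y′≋) y≋y′ with s≡s′
      where
      s≡s′ : s ≡ s′
      s≡s′ = ⟦⟧-injective-mod (cancelˡ base
        (mod-trans (mod-sym (modN⇒modd y≋)) (mod-trans (subʳ x y≋y′) (modN⇒modd y′≋))))
    ... | refl = ⟦⟧-injective-mod (cancelʳ x (mod-trans y≋ (mod-sym y′≋)))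

    -- Cancelling x from x + y ≡ 2x + hd + r shows that a clash could occur only in a displaced
    -- cell.
    mixed⇒middle : ∀ {x y : Fin N} {y′ : Fin d} →
                   res N (⟦ x ⟧ ℤ.+ ⟦ y ⟧) ≡ res N (mixedSymbol ⟦ x ⟧ ⟦ y′ ⟧) → Middle (⟦ y ⟧ ℤ.- ⟦ x ⟧)
    mixed⇒middle {x} {y} {y′} eq = r , mod-by (ident ⟦ x ⟧ ⟦ y ⟧ (base ℤ.+ ⟦ r ⟧)) (res-injective eq)
      where
      r : Fin d
      r = res d (⟦ y′ ⟧ ℤ.- ⟦ x ⟧)
      ident : ∀ x y b → (y ℤ.- x) ℤ.- b ≡ (x ℤ.+ y) ℤ.- (x ℤ.+ x ℤ.+ b)
      ident = solve-∀

    mixed-mod : ∀ x y → mixedSymbol x y ≋ y ℤ.+ (x ℤ.+ base) [mod d ]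
    mixed-mod x y = mod-by (ident x y base ⟦ res d (y ℤ.- x) ⟧) (mod-sym (res-spec d (y ℤ.- x)))
      where
      ident : ∀ x y b r → (x ℤ.+ x ℤ.+ (b ℤ.+ r)) ℤ.- (y ℤ.+ (x ℤ.+ b)) ≡ r ℤ.- (y ℤ.- x)
      ident = solve-∀

  longCell-injective : ∀ x {y y′} D₁ D₂ → longCell x y D₁ ≡ longCell x y′ D₂ → y ≡ y′
  longCell-injective x (yes m₁) (yes m₂) eq =
    middle-injective ⟦ x ⟧ m₁ m₂ (cancelˡ ⟦ x ⟧ (res-injective (snd-injective eq)))
  longCell-injective x (no _)   (no _)   eq = ⟦⟧-injective-mod (cancelˡ ⟦ x ⟧ (res-injective (snd-injective eq)))
  longCell-injective x (yes _)  (no _)   ()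
  longCell-injective x (no _)   (yes _)  ()

  longCell≢mixed : ∀ x {y} {y′ : Fin d} D₁ → ¬ longCell x y D₁ ≡ long (res N (mixedSymbol ⟦ x ⟧ ⟦ y′ ⟧))
  longCell≢mixed x (yes _)  ()
  longCell≢mixed x {y} {y′} (no ¬m) eq = ¬m (mixed⇒middle {x} {y} {y′} (snd-injective eq))

  row-injective : ∀ p {q q′} → cell p q ≡ cell p q′ → q ≡ q′
  row-injective (long x) {long y} {long y′} eq = cong (λ j → long j) (longCell-injective x (middle? _) (middle? _) eq)
  row-injective (long x) {long y} {short y′} eq = contradiction eq (longCell≢mixed x (middle? _))
  row-injective (long x) {short y} {long y′} eq = contradiction (sym eq) (longCell≢mixed x (middle? _))
  row-injective (long x) {short y} {short y′} eq = cong (λ j → short j) (⟦⟧-injective-mod (cancelʳ ⟦ x ⟧ (res-injective residues)))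
    where
    residues : res d (⟦ y ⟧ ℤ.- ⟦ x ⟧) ≡ res d (⟦ y′ ⟧ ℤ.- ⟦ x ⟧)
    residues = ⟦⟧-injective-mod (modN⇒modd (cancelˡ base (cancelˡ (⟦ x ⟧ ℤ.+ ⟦ x ⟧) (res-injective (snd-injective eq)))))
  -- Modulo d the symbols give x ≡ x′ by `mixed-mod`. The offsets then agree, leaving 2x ≡ 2x′
  -- modulo N for `halve-mod`.
  row-injective (short y) {long x} {long x′} eq = cong (λ j → long j) (⟦⟧-injective-mod (halve-mod x≋x′ doubles))
    where
    y′ : ℤ
    y′ = ⟦ y ⟧ ℤ.- 1ℤ
    mixed-eq : mixedSymbol ⟦ x ⟧ y′ ≋ mixedSymbol ⟦ x′ ⟧ y′ [mod N ]
    mixed-eq = cancelˡ 1ℤ (res-injective (snd-injective eq))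
    ident₁ : ∀ y b x x′ → x ℤ.- x′ ≡ (y ℤ.+ (x ℤ.+ b)) ℤ.- (y ℤ.+ (x′ ℤ.+ b))
    ident₁ = solve-∀
    x≋x′ : ⟦ x ⟧ ≋ ⟦ x′ ⟧ [mod d ]
    x≋x′ = mod-by (ident₁ y′ base ⟦ x ⟧ ⟦ x′ ⟧)
      (mod-trans (mod-sym (mixed-mod ⟦ x ⟧ y′)) (mod-trans (modN⇒modd mixed-eq) (mixed-mod ⟦ x′ ⟧ y′)))
    ident₂ : ∀ y x x′ → (y ℤ.- x) ℤ.- (y ℤ.- x′) ≡ x′ ℤ.- x
    ident₂ = solve-∀
    residues : res d (y′ ℤ.- ⟦ x′ ⟧) ≡ res d (y′ ℤ.- ⟦ x ⟧)
    residues = res-cong (mod-by (ident₂ y′ ⟦ x′ ⟧ ⟦ x ⟧) x≋x′)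
    ident₃ : ∀ x x′ b → (x ℤ.+ x) ℤ.- (x′ ℤ.+ x′) ≡ (x ℤ.+ x ℤ.+ b) ℤ.- (x′ ℤ.+ x′ ℤ.+ b)
    ident₃ = solve-∀
    doubles : ⟦ x ⟧ ℤ.+ ⟦ x ⟧ ≋ ⟦ x′ ⟧ ℤ.+ ⟦ x′ ⟧ [mod N ]
    doubles = mod-by (ident₃ ⟦ x ⟧ ⟦ x′ ⟧ (base ℤ.+ ⟦ res d (y′ ℤ.- ⟦ x ⟧) ⟧))
      (subst (λ r → mixedSymbol ⟦ x ⟧ y′ ≋ ⟦ x′ ⟧ ℤ.+ ⟦ x′ ⟧ ℤ.+ (base ℤ.+ ⟦ r ⟧) [mod N ]) residues mixed-eq)
  row-injective (short y) {long _} {short _} ()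
  row-injective (short y) {short _} {long _} ()
  row-injective (short y) {short x} {short x′} eq = cong (λ j → short j) (⟦⟧-injective-mod (cancelˡ ⟦ y ⟧ (res-injective (snd-injective eq))))

theorem4p15 : (d₁ d₂ f n : ℕ) → d₁ > d₂ → d₂ > 1 → n ≡ d₁ + d₂ + f →
    (β : Permutation′ n) → HasCycleStructure β (d₁ ∷ d₂ ∷ replicate f 1) →
    (⟨ id , β , β ⨾ [12] ⟩ ∈ Par n) ⇔ ((∃[ k ] (d₁ ≡ k * d₂ × parity k ≡ 1ℙ)) × f ≡ 0)
theorem4p15 (suc e₁) (suc e₂) f n d₁>d₂ d₂>1 n≡ β H = mk⇔ necessity sufficiency
  where
  open Transfer H
  necessity : ⟨ id , β , β ⨾ [12] ⟩ ∈ Par n → (∃[ k ] (suc e₁ ≡ k * suc e₂ × parity k ≡ 1ℙ)) × f ≡ 0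
  necessity par = (quotient d₂∣d₁ , equality d₂∣d₁ , odd-quotient (quotient d₂∣d₁) (equality d₂∣d₁)) , no-fixed-points
    where
    open ℕ∣._∣_
    open Necessity e₁ e₂ f d₁>d₂ (Par⇒ShiftSquare par)
  sufficiency : (∃[ k ] (suc e₁ ≡ k * suc e₂ × parity k ≡ 1ℙ)) × f ≡ 0 → ⟨ id , β , β ⨾ [12] ⟩ ∈ Par n
  sufficiency ((k , d₁≡kd₂ , k-odd) , refl) with odd-half k k-odd
  ... | h , refl with d₁≡kd₂
  -- After the matches d₁ is literally the `N` of `Construction`, and the list of cycle lengths has
  -- just two entries.
  ...   | refl = symmetricRows⇒Par cell cell-shift row-injective
    where open Construction (suc e₂) h
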